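{- There exist strings of length $n$ for which Algorithm III uses only $O(n)$ space, while Algorithm II needs $\Theta(n^2)$ space.
   Context: **Problem.** Strings are over an alphabet $\Sigma$. A subsequence of a string is obtained by deleting zero or more characters; a substring is a contiguous block. $\mathrm{lcs}(X,Y)$ is the length of a longest common subsequence of $X$ and $Y$, and $X^R$ is the reversal of $X$. The input consists of two target strings $A,B$ of length $n$ (the "strings of length $n$" of the claim) and a pattern $P$ of length $r\le n$. A string $Z$ is an STR-IC-LCS of $A,B,P$ if it is a longest string such that $P$ is a substring of $Z$ and $Z$ is a common subsequence of $A$ and $B$; if there is none, its length is taken to be $-1$ by convention. The STR-IC-LCS problem is to compute such a $Z$. Write $\ell=\mathrm{lcs}(A,B)$ and let $\ell'$ be the length of an STR-IC-LCS of $A,B,P$. A minimal interval of $A$ is an interval $[i..j]$ such that $P$ is a subsequence of $A[i..j]$ but of neither $A[i+1..j]$ nor $A[i..j-1]$; similarly for $B$. The STR-IC-LCS length is the maximum, over pairs of minimal intervals $[b_A..e_A]$ of $A$ and $[b_B..e_B]$ of $B$, of $\mathrm{lcs}(A[1..b_A-1],B[1..b_B-1])+r+\mathrm{lcs}(A[e_A+1..n],B[e_B+1..n])$; the first and last terms are called prefix-LCS and suffix-LCS values. **Sparse tables.** For $s,i\in[1..n]$ let $f_A(s,i)$ be the length of the shortest prefix of $B$ whose longest common subsequence with $A[1..i]$ has length $s$ ($\infty$ if there is none). The sparse table $F_A$ stores $f_A(s,i)$, except that $F_A(s,i)$ is undefined if $s>i$, or $(s,i)$ lies on a diagonal $i-s+1>n-\ell+1$,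 or $F_A(s-1,i-1)$ is $\infty$ or undefined. $F_B$ is defined with the roles of $A$ and $B$ exchanged, and $F_{A^R},F_{B^R}$ are the analogous tables for $A^R,B^R$. **Algorithm II.** It computes all minimal intervals of $A$ and $B$ in $O(nr/\log r)$ time and $O(n)$ space; stores them in two arrays of size $n$ indexed by beginning position (positions where no interval begins point to the next position where one does); builds $F_A,F_B,F_{A^R},F_{B^R}$; and obtains the prefix-LCS values from $F_A,F_B$ and the suffix-LCS values from $F_{A^R},F_{B^R}$, skipping pairs of intervals that would only rescan the same table cell, with two further arrays of size $n$ recording where to restart scanning in the columns of $F_{A^R}$ and $F_{B^R}$. It runs in $O(nr/\log r+n(n-\ell+1))$ time and $O((\ell+1)(n-\ell+1))$ space. **Algorithm III.** It first computes the minimal intervals as in Algorithm II. Let $\max b_A$ and $\max b_B$ be the beginning positions of the rightmost minimal intervals in $A$ and $B$. For the prefix-LCS queries it applies the method of Algorithm II with the sparse tables and other auxiliary tables built only for $\hat A=A[1..\max b_A-1]$ and $\hat B=B[1..\max b_B-1]$; the same techniques are used for the suffix-LCS queries. It runs in $O(nr/\log r+n(n-\ell'+1))$ time and $O((\ell'+1)(n-\ell'+1))$ space. -}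

module Defs where

open import Data.Nat using (ℕ; zero; suc; _+_; _*_; _∸_; _≤_; _≤?_)
import Data.Nat as ℕ
open import Data.Fin using (Fin)
import Data.Fin as Fin
open import Data.Bool using (if_then_else_; _∨_)
open import Data.Maybe using (Maybe; just; nothing)
open import Data.Product using (_×_; _,_; proj₁; proj₂)
open import Data.List using (List; []; _∷_; _++_; length; map; filter; take; drop; head;
  reverse; upTo; applyUpTo; cartesianProduct; mapMaybe)
open import Data.List.Extrema.Nat using (max; min)
open import Data.List.Relation.Binary.Sublist.Propositional using (_⊆_)
import Data.List.Relation.Binary.Sublist.DecPropositional as DecSublist
open import Relation.Binary.PropositionalEquality using (_≡_)
open import Relation.Nullary using (Dec; ¬_; ¬?; does)
open import Relation.Nullary.Decidable using (_×-dec_)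
open import Relation.Nullary.Construct.Add.Supremum using (_⁺; ⊤⁺; [_])

String : ℕ → Set
String σ = List (Fin σ)

private variable
  σ n : ℕ

_⊆?_ : (X Y : String σ) → Dec (X ⊆ Y)
_⊆?_ = DecSublist._⊆?_ Fin._≟_

record Input (σ n : ℕ) : Set where
  field
    A B P : String σ
    |A|≡n : length A ≡ n
    |B|≡n : length B ≡ n
    1≤r   : 1 ≤ length P
    r≤n   : length P ≤ n

-- Positions in strings are 1-based throughout.
[1⋯_] : ℕ → List ℕ
[1⋯ n ] = applyUpTo suc n

-- X [ i ⋯ j ] is the empty string when i > j.
_[_⋯_] : String σ → ℕ → ℕ → String σ
X [ i ⋯ j ] = drop (i ∸ 1) (take j X)

subsequences : String σ → List (String σ)
subsequences []       = [] ∷ []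
subsequences (x ∷ xs) = subsequences xs ++ map (x ∷_) (subsequences xs)

-- The default 0 is harmless: [] is always a common subsequence.
lcs : String σ → String σ → ℕ
lcs X Y = max 0 (map length (filter (_⊆? Y) (subsequences X)))

-- f X Y s i is f_X(s,i): the first j, in increasing order, with
-- lcs(X[1..i], Y[1..j]) = s, or ∞ (= ⊤⁺).
f : String σ → String σ → ℕ → ℕ → ℕ ⁺
f X Y s i = head (filter (λ j → lcs (take i X) (take j Y) ℕ.≟ s) (upTo (suc (length Y))))

-- The sparse table F_X of X against Y; `nothing` is an undefined entry and
-- `just ⊤⁺` a stored ∞.  Row 0 is not part of the table: it is the boundary
-- value f_X(0,i) = 0 that the recursive clause needs for s = 1.
-- The subtractions i ∸ s (for s ≤ i) and |X| ∸ lcs X Y are never truncated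
-- where they matter.
F : String σ → String σ → ℕ → ℕ → Maybe (ℕ ⁺)
F X Y zero    i       = just (f X Y 0 i)
F X Y (suc s) zero    = nothing
F X Y (suc s) (suc i) =
  if does (suc i ℕ.<? suc s)
     ∨ does (length X ∸ lcs X Y + 1 ℕ.<? suc i ∸ suc s + 1)
  then nothing
  else extend (F X Y s i)
  where
  extend : Maybe (ℕ ⁺) → Maybe (ℕ ⁺)
  extend (just [ _ ]) = just (f X Y (suc s) (suc i))
  extend (just ⊤⁺)    = nothing
  extend nothing      = nothing

-- The contents of the table, one item per stored entry.
table : String σ → String σ → List (ℕ ⁺)
table X Y = mapMaybe (λ (s , i) → F X Y s i)
                     (cartesianProduct [1⋯ length X ] [1⋯ length X ])

IsMinimalInterval : String σ → String σ → ℕ × ℕ → Set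
IsMinimalInterval P X (i , j) =
  P ⊆ (X [ i ⋯ j ]) × ¬ P ⊆ (X [ suc i ⋯ j ]) × ¬ P ⊆ (X [ i ⋯ j ∸ 1 ])

isMinimalInterval? : (P X : String σ) (I : ℕ × ℕ) → Dec (IsMinimalInterval P X I)
isMinimalInterval? P X (i , j) =
  (P ⊆? (X [ i ⋯ j ])) ×-dec ¬? (P ⊆? (X [ suc i ⋯ j ])) ×-dec ¬? (P ⊆? (X [ i ⋯ j ∸ 1 ]))

minimalIntervals : String σ → String σ → List (ℕ × ℕ)
minimalIntervals P X =
  filter (isMinimalInterval? P X) (cartesianProduct [1⋯ length X ] [1⋯ length X ])

-- X[1..max b − 1], with max b the beginning of the rightmost minimal interval.
-- When X has no minimal interval this, like `trimmedSuffix`, is empty.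
trimmedPrefix : String σ → String σ → String σ
trimmedPrefix P X = take (max 0 (map proj₁ (minimalIntervals P X)) ∸ 1) X

-- X[min e + 1..n], with min e the end of the leftmost minimal interval.
trimmedSuffix : String σ → String σ → String σ
trimmedSuffix P X = drop (min (length X) (map proj₂ (minimalIntervals P X))) X

-- Space is counted in machine words: one per array cell and one per stored
-- table entry.

prefixSpace : String σ → String σ → ℕ
prefixSpace X Y = length (table X Y) + length (table Y X)

-- The extra |X| + |Y| words are the two arrays of restart positions, one for
-- each of the reversed tables.
suffixSpace : String σ → String σ → ℕ
suffixSpace X Y =
  length (table (reverse X) (reverse Y)) + length (table (reverse Y) (reverse X))
  + (length X + length Y)

-- The working space of the procedure computing the minimal intervals (and of
-- any scalar variables) is only known up to a constant factor, so it is a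
-- parameter shared by both algorithms.
WorkSpace : Set
WorkSpace = ∀ {σ n} → Input σ n → ℕ

-- Interval computation together with the two arrays of minimal intervals
-- indexed by beginning position.
intervalSpace : WorkSpace → Input σ n → ℕ
intervalSpace w I = w I + (length A + length B)
  where open Input I

spaceII : WorkSpace → Input σ n → ℕ
spaceII w I = intervalSpace w I + prefixSpace A B + suffixSpace A B
  where open Input I

spaceIII : WorkSpace → Input σ n → ℕ
spaceIII w I =
  intervalSpace w I
  + prefixSpace (trimmedPrefix P A) (trimmedPrefix P B)
  + suffixSpace (trimmedSuffix P A) (trimmedSuffix P B)
  where open Input I

-- Take P = x y and A = x aᵖ b^q y, B = x aᵖ⁺ᵠ y with p and q about n/2.  The
-- only minimal interval of either string is [1..n], so Algorithm III builds its
-- tables for empty strings.  But lcs(A,B) ≤ p + 2, so at least q + 1 diagonals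
-- are kept, and the common prefix x aᵖ makes their first p + 2 entries stored.
module Submission where

open import Defs
open import Data.Nat using (ℕ; _*_; _≤_)
open import Data.Product using (Σ-syntax; ∃-syntax; _×_)
open import Data.List.Relation.Binary.Sublist.Propositional using (_⊆_)
open import Data.Nat using (zero; suc; _+_; _∸_; _⊓_; _<_; _<?_; z≤n; s≤s; s≤s⁻¹; ⌊_/2⌋; ⌈_/2⌉)
open import Data.Nat.Properties
open import Data.Nat.Tactic.RingSolver using (solve-∀)
open import Data.Fin using (Fin)
open import Data.Fin.Patterns using (0F; 1F; 2F; 3F)
open import Data.Maybe using (Maybe; just; nothing)
open import Data.Product using (_,_; proj₁; proj₂)
open import Data.Sum using (inj₁; inj₂)
open import Data.List
  using (List; []; _∷_; _++_; length; map; filter; take; head; reverse; applyUpTo;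
         cartesianProduct; mapMaybe; replicate)
open import Data.List.Properties
open import Data.List.Extrema.Nat using (max≤v⁺; v≤max⁺; v≤min⁺)
open import Data.List.Membership.Propositional using (_∈_; lose)
open import Data.List.Membership.Propositional.Properties
  using (∈-++⁺ˡ; ∈-++⁺ʳ; ∈-++⁻; ∈-map⁺; ∈-map⁻; ∈-filter⁺; ∈-filter⁻; ∈-upTo⁺)
open import Data.List.Relation.Unary.Any using (here; there)
open import Data.List.Relation.Unary.All as All using (All; []; _∷_)
import Data.List.Relation.Unary.All.Properties as All
open import Data.List.Relation.Binary.Sublist.Propositional
  using ([]; _∷_; _∷ʳ_; ⊆-refl; ⊆-trans; ⊆-reflexive; minimum; lookup)
open import Data.List.Relation.Binary.Sublist.Propositional.Properties
  using (length-mono-≤; take-⊆; drop-⊆; take⁺; All-resp-⊆; ++⁺ˡ)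
open import Relation.Binary.PropositionalEquality
  using (_≡_; _≢_; refl; sym; trans; cong; cong₂; subst; subst₂; module ≡-Reasoning)
open import Relation.Nullary using (contradiction)
open import Relation.Nullary.Construct.Add.Supremum using ([_])
open import Relation.Nullary.Decidable using (dec-false)
open import Relation.Unary using (Pred; Decidable)
open import Function using (_∘_)
open import Level using (0ℓ)

private variable
  σ : ℕ
  S T : Set
  X Y Z : String σ

-- Subsequences and bounds on `lcs`.

⊆⇒∈-subsequences : Z ⊆ X → Z ∈ subsequences X
⊆⇒∈-subsequences []         = here refl
⊆⇒∈-subsequences (_ ∷ʳ τ)   = ∈-++⁺ˡ (⊆⇒∈-subsequences τ)
⊆⇒∈-subsequences (refl ∷ τ) = ∈-++⁺ʳ _ (∈-map⁺ _ (⊆⇒∈-subsequences τ))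

∈-subsequences⇒⊆ : (X : String σ) → Z ∈ subsequences X → Z ⊆ X
∈-subsequences⇒⊆ []      (here refl) = []
∈-subsequences⇒⊆ (x ∷ X) Z∈ with ∈-++⁻ (subsequences X) Z∈
... | inj₁ Z∈X = x ∷ʳ ∈-subsequences⇒⊆ X Z∈X
... | inj₂ Z∈xX with ∈-map⁻ (x ∷_) Z∈xX
...   | _ , W∈X , refl = refl ∷ ∈-subsequences⇒⊆ X W∈X

lcs-upper : ∀ {k} (X Y : String σ) → (∀ {Z} → Z ⊆ X → Z ⊆ Y → length Z ≤ k) → lcs X Y ≤ k
lcs-upper X Y bound = max≤v⁺ z≤n (All.map⁺ (All.tabulate λ Z∈ →
  let Z∈X , Z⊆Y = ∈-filter⁻ (_⊆? Y) {xs = subsequences X} Z∈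
  in bound (∈-subsequences⇒⊆ X Z∈X) Z⊆Y))

lcs-lower : Z ⊆ X → Z ⊆ Y → length Z ≤ lcs X Y
lcs-lower {Y = Y} Z⊆X Z⊆Y = v≤max⁺ 0 _
  (inj₂ (lose (∈-map⁺ length (∈-filter⁺ (_⊆? Y) (⊆⇒∈-subsequences Z⊆X) Z⊆Y)) ≤-refl))

⊆⇒lcs≡length : Y ⊆ X → lcs X Y ≡ length Y
⊆⇒lcs≡length {Y = Y} {X = X} Y⊆X =
  ≤-antisym (lcs-upper X Y (λ _ → length-mono-≤)) (lcs-lower Y⊆X ⊆-refl)

-- Searching and counting in lists.

head-filter-just : ∀ {Q : Pred S 0ℓ} (Q? : Decidable Q) {x} {xs : List S} →
                   x ∈ xs → Q x → ∃[ y ] head (filter Q? xs) ≡ just y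
head-filter-just Q? {xs = xs} x∈xs Qx with filter Q? xs | ∈-filter⁺ Q? x∈xs Qx
... | y ∷ _ | _ = y , refl

length-cartesianProduct : (xs : List S) (ys : List T) →
                          length (cartesianProduct xs ys) ≡ length xs * length ys
length-cartesianProduct []       ys = refl
length-cartesianProduct (x ∷ xs) ys =
  trans (length-++ (map (x ,_) ys))
        (cong₂ _+_ (length-map (x ,_) ys) (length-cartesianProduct xs ys))

-- The window starts at an arbitrary `a` because the stored block in a table row shifts right with
-- the row. Induction first skips `a` positions, which can only add to the count, and then counts
-- `d` defined ones.
mapMaybe-applyUpTo-lower : ∀ (g : S → Maybe T) (h : ℕ → S) a d n → a + d ≤ n →
  (∀ i → a ≤ i → i < a + d → ∃[ v ] g (h i) ≡ just v) →
  d ≤ length (mapMaybe g (applyUpTo h n))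
mapMaybe-applyUpTo-lower g h zero    zero    n       _  _  = z≤n
mapMaybe-applyUpTo-lower g h zero    (suc d) (suc n) le gh
  rewrite proj₂ (gh 0 z≤n (s≤s z≤n)) =
  s≤s (mapMaybe-applyUpTo-lower g (h ∘ suc) 0 d n (s≤s⁻¹ le) λ i _ i<d → gh (suc i) z≤n (s≤s i<d))
mapMaybe-applyUpTo-lower g h (suc a) d       (suc n) le gh
  with ih ← mapMaybe-applyUpTo-lower g (h ∘ suc) a d n (s≤s⁻¹ le)
              (λ i a≤i i<a+d → gh (suc i) (s≤s a≤i) (s≤s i<a+d))
     | g (h 0)
... | just _  = m≤n⇒m≤1+n ih
... | nothing = ih

-- The product is listed row by row, so the contributions of the first `m` rows add up.
mapMaybe-cartesianProduct-lower : ∀ {U : Set} (g : S × T → Maybe U) (h : ℕ → S) ys c m n → m ≤ n →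
  (∀ i → i < m → c ≤ length (mapMaybe (g ∘ (h i ,_)) ys)) →
  m * c ≤ length (mapMaybe g (cartesianProduct (applyUpTo h n) ys))
mapMaybe-cartesianProduct-lower g h ys c zero    n       _  _    = z≤n
mapMaybe-cartesianProduct-lower g h ys c (suc m) (suc n) le rows = begin
  c + m * c
    ≤⟨ +-mono-≤ (rows 0 (s≤s z≤n))
                (mapMaybe-cartesianProduct-lower g (h ∘ suc) ys c m n (s≤s⁻¹ le)
                  λ i i<m → rows (suc i) (s≤s i<m)) ⟩
  length (mapMaybe (g ∘ (h 0 ,_)) ys) + length (mapMaybe g rest)
    ≡⟨ cong (λ r → length r + length (mapMaybe g rest)) (mapMaybe-map g (h 0 ,_) ys) ⟨
  length (mapMaybe g row) + length (mapMaybe g rest)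
    ≡⟨ length-++ (mapMaybe g row) ⟨
  length (mapMaybe g row ++ mapMaybe g rest)
    ≡⟨ cong length (mapMaybe-++ g row rest) ⟨
  length (mapMaybe g (row ++ rest)) ∎
  where
  open ≤-Reasoning
  row  = map (h 0 ,_) ys
  rest = cartesianProduct (applyUpTo (h ∘ suc) n) ys

-- Sizes of sparse tables.

table-upper : (X Y : String σ) → length (table X Y) ≤ length X * length X
table-upper X Y = begin
  length (table X Y)                                        ≤⟨ length-mapMaybe _ (cartesianProduct positions positions) ⟩
  length (cartesianProduct positions positions)             ≡⟨ length-cartesianProduct positions positions ⟩
  length positions * length positions                       ≡⟨ cong (λ l → l * l) (length-applyUpTo suc (length X)) ⟩
  length X * length X                                       ∎
  where
  open ≤-Reasoning
  positions = [1⋯ length X ]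

module _ {X Y : String σ} {m d : ℕ}
         (m≤|Y| : m ≤ length Y) (prefix : take m X ≡ take m Y) (d≤ : d ≤ length X ∸ lcs X Y) where

  -- The search succeeds because `j = s` qualifies: inside the common prefix `take s Y` equals
  -- `take s X`, which is a subsequence of `take i X`.
  f-finite : ∀ {s i} → s ≤ i → s ≤ m → ∃[ j ] f X Y s i ≡ [ j ]
  f-finite {s} {i} s≤i s≤m = head-filter-just (λ j → lcs (take i X) (take j Y) ≟ s) (∈-upTo⁺ (s≤s s≤|Y|)) (begin
    lcs (take i X) (take s Y) ≡⟨ ⊆⇒lcs≡length (⊆-trans (⊆-reflexive (sym takes)) (take⁺ s≤i)) ⟩
    length (take s Y)         ≡⟨ length-take s Y ⟩
    s ⊓ length Y              ≡⟨ m≤n⇒m⊓n≡m s≤|Y| ⟩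
    s                         ∎)
    where
    open ≡-Reasoning
    s≤|Y| = ≤-trans s≤m m≤|Y|
    takes : take s X ≡ take s Y
    takes = begin
      take s X          ≡⟨ cong (λ k → take k X) (m≤n⇒m⊓n≡m s≤m) ⟨
      take (s ⊓ m) X    ≡⟨ take-take s m X ⟨
      take s (take m X) ≡⟨ cong (take s) prefix ⟩
      take s (take m Y) ≡⟨ take-take s m Y ⟩
      take (s ⊓ m) Y    ≡⟨ cong (λ k → take k Y) (m≤n⇒m⊓n≡m s≤m) ⟩
      take s Y          ∎

  -- Mutual induction down a diagonal: an entry is stored once its predecessor is finite, and a
  -- stored entry within the common prefix is finite. Since only the predecessor must lie in the
  -- prefix, `F-stored` reaches one row further, to row `suc m`.
  F-finite : ∀ s i → s ≤ i → i ≤ s + d → s ≤ m → ∃[ j ] F X Y s i ≡ just [ j ]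
  F-stored : ∀ s i → s ≤ i → i ≤ s + d → s ≤ m → F X Y (suc s) (suc i) ≡ just (f X Y (suc s) (suc i))

  F-finite zero    i       s≤i i≤s+d s≤m =
    let j , eq = f-finite s≤i s≤m in j , cong just eq
  F-finite (suc s) (suc i) s≤i i≤s+d s≤m =
    let j , eq = f-finite s≤i s≤m
    in j , trans (F-stored s i (s≤s⁻¹ s≤i) (s≤s⁻¹ i≤s+d) (<⇒≤ s≤m)) (cong just eq)

  F-stored s i s≤i i≤s+d s≤m
    -- Both guards of `F` fail: the entry is not below the main diagonal, and its diagonal `i ∸ s`
    -- is at most `d`, hence among those kept.
    rewrite dec-false (suc i <? suc s) (≤⇒≯ (s≤s s≤i))
          | dec-false (length X ∸ lcs X Y + 1 <? i ∸ s + 1)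
              (≤⇒≯ (+-monoˡ-≤ 1 (≤-trans (m≤n+o⇒m∸n≤o i s i≤s+d) d≤)))
          | proj₂ (F-finite s i s≤i i≤s+d s≤m) = refl

  -- The stored entries include a parallelogram: rows 1 to `suc m`, each with `suc d` consecutive
  -- columns starting on the main diagonal. The hypothesis keeps its far corner inside the table.
  table-lower : suc (m + d) ≤ length X → suc m * suc d ≤ length (table X Y)
  table-lower m+d<|X| =
    mapMaybe-cartesianProduct-lower _ suc [1⋯ length X ] (suc d) (suc m) (length X)
      (≤-trans (s≤s (m≤m+n m d)) m+d<|X|) λ s s<1+m →
    mapMaybe-applyUpTo-lower (F X Y (suc s)) suc s (suc d) (length X)
      (≤-trans (≤-reflexive (+-suc s d)) (≤-trans (s≤s (+-monoˡ-≤ d (s≤s⁻¹ s<1+m))) m+d<|X|)) λ i s≤i i<s+1+d →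
    _ , F-stored s i s≤i (s≤s⁻¹ (≤-trans i<s+1+d (≤-reflexive (+-suc s d)))) (s≤s⁻¹ s<1+m)

-- Four tables of at most n² entries and four arrays of size n join the working space. The linear
-- terms are absorbed by n ≤ n², which follows from 1 ≤ r ≤ n.
spaceII-upper : (w : WorkSpace) {k n : ℕ} (I : Input σ n) → w I ≤ k * n → spaceII w I ≤ (k + 8) * (n * n)
spaceII-upper w {k} {n} I w≤kn = begin
  spaceII w I
    ≤⟨ +-mono-≤ (+-mono-≤ (+-mono-≤ w≤kn lengths)
                          (+-mono-≤ (square A B |A|≡n) (square B A |B|≡n)))
                (+-mono-≤ (+-mono-≤ (square (reverse A) (reverse B) (trans (length-reverse A) |A|≡n))
                                    (square (reverse B) (reverse A) (trans (length-reverse B) |B|≡n)))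
                          lengths) ⟩
  k * n + (n + n) + (n * n + n * n) + (n * n + n * n + (n + n))
    ≡⟨ collect k n (n * n) ⟩
  (k + 4) * n + 4 * (n * n)
    ≤⟨ +-monoˡ-≤ (4 * (n * n)) (*-monoʳ-≤ (k + 4) n≤n²) ⟩
  (k + 4) * (n * n) + 4 * (n * n)
    ≡⟨ *-distribʳ-+ (n * n) (k + 4) 4 ⟨
  (k + 4 + 4) * (n * n)
    ≡⟨ cong (_* (n * n)) (+-assoc k 4 4) ⟩
  (k + 8) * (n * n) ∎
  where
  open Input I
  open ≤-Reasoning
  lengths : length A + length B ≤ n + n
  lengths = ≤-reflexive (cong₂ _+_ |A|≡n |B|≡n)
  square : ∀ X Y → length X ≡ n → length (table X Y) ≤ n * n
  square X Y eq = ≤-trans (table-upper X Y) (≤-reflexive (cong (λ l → l * l) eq))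
  n≤n² : n ≤ n * n
  n≤n² = ≤-trans (≤-reflexive (sym (*-identityʳ n))) (*-monoʳ-≤ n (≤-trans 1≤r r≤n))
  collect : ∀ k n N → k * n + (n + n) + (N + N) + (N + N + (n + n)) ≡ (k + 4) * n + 4 * N
  collect = solve-∀

-- Inputs whose trimmed strings are empty.

trimmedPrefix-empty : (P X : String σ) → (∀ I → IsMinimalInterval P X I → proj₁ I ≤ 1) →
                      trimmedPrefix P X ≡ []
trimmedPrefix-empty P X starts =
  cong (λ k → take k X) (m≤n⇒m∸n≡0 (max≤v⁺ z≤n (All.map⁺ (All.map (λ {I} → starts I)
    (All.all-filter (isMinimalInterval? P X) (cartesianProduct [1⋯ length X ] [1⋯ length X ]))))))

trimmedSuffix-empty : (P X : String σ) → (∀ I → IsMinimalInterval P X I → length X ≤ proj₂ I) →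
                      trimmedSuffix P X ≡ []
trimmedSuffix-empty P X ends =
  -- `≤-refl` accounts for the default `length X` of `min`.
  drop-all _ X (v≤min⁺ ≤-refl (All.map⁺ (All.map (λ {I} → ends I)
    (All.all-filter (isMinimalInterval? P X) (cartesianProduct [1⋯ length X ] [1⋯ length X ])))))

-- Positions of letters and blocks in strings.

∈-take-++⇒< : ∀ {y : Fin σ} {us vs} j → All (y ≢_) us → y ∈ take j (us ++ vs) → length us < j
∈-take-++⇒< (suc j) []           _          = s≤s z≤n
∈-take-++⇒< (suc j) (y≢u ∷ _)    (here y≡u) = contradiction y≡u y≢u
∈-take-++⇒< (suc j) (_ ∷ y∉us)   (there y∈) = s≤s (∈-take-++⇒< j y∉us y∈)

substring-∷-⊆ : ∀ (x : Fin σ) X i j → ((x ∷ X) [ suc (suc i) ⋯ j ]) ⊆ X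
substring-∷-⊆ x X i zero    = minimum X
substring-∷-⊆ x X i (suc j) = ⊆-trans (drop-⊆ i (take j X)) (take-⊆ j X)

-- No letter of `Z` can be matched inside the block of `b`s, so that block contributes nothing.
length-avoiding : ∀ {b : Fin σ} us q {vs} → All (b ≢_) Z → Z ⊆ us ++ replicate q b ++ vs →
                  length Z ≤ length us + length vs
length-avoiding []       zero    _           τ          = length-mono-≤ τ
length-avoiding []       (suc q) b∉Z         (_ ∷ʳ τ)   = length-avoiding [] q b∉Z τ
length-avoiding []       (suc q) (b≢b ∷ _)   (refl ∷ τ) = contradiction refl b≢b
length-avoiding (u ∷ us) q       b∉Z         (_ ∷ʳ τ)   = m≤n⇒m≤1+n (length-avoiding us q b∉Z τ)
length-avoiding (u ∷ us) q       (_ ∷ b∉Z)   (refl ∷ τ) = s≤s (length-avoiding us q b∉Z τ)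

take-replicate-++ : ∀ (a : S) p q us vs → take p (replicate p a ++ us) ≡ take p (replicate (p + q) a ++ vs)
take-replicate-++ a zero    q us vs = refl
take-replicate-++ a (suc p) q us vs = cong (a ∷_) (take-replicate-++ a p q us vs)

-- The example strings, their minimal intervals and their table.

-- The letters x, a, b, y are 0F, 1F, 2F, 3F.
pattern-xy : String 4
pattern-xy = 0F ∷ 3F ∷ []

-- One family serves both strings: B is `word (p + q) 0`, so each fact about minimal intervals is
-- proved once.
word : ℕ → ℕ → String 4
word p q = 0F ∷ replicate p 1F ++ replicate q 2F ++ 3F ∷ []

length-word : ∀ p q → length (word p q) ≡ 2 + (p + q)
length-word p q = cong suc (begin
  length (as ++ bs ++ 3F ∷ [])       ≡⟨ length-++ as ⟩
  length as + length (bs ++ 3F ∷ []) ≡⟨ cong₂ _+_ (length-replicate p) (length-++ bs) ⟩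
  p + (length bs + 1)                ≡⟨ cong (λ l → p + (l + 1)) (length-replicate q) ⟩
  p + (q + 1)                        ≡⟨ cong (p +_) (+-comm q 1) ⟩
  p + suc q                          ≡⟨ +-suc p q ⟩
  suc (p + q)                        ∎)
  where
  open ≡-Reasoning
  as = replicate p 1F
  bs : String 4
  bs = replicate q 2F

pattern-⊆-word : ∀ p q → pattern-xy ⊆ word p q
pattern-⊆-word p q = refl ∷ ++⁺ˡ (replicate p 1F) (++⁺ˡ (replicate q 2F) ⊆-refl)

-- The letter x occurs only at position 1, so an interval beginning later misses it.
minimalInterval-start : ∀ p q I → IsMinimalInterval pattern-xy (word p q) I → proj₁ I ≤ 1
minimalInterval-start p q (zero        , _) _        = z≤n
minimalInterval-start p q (suc zero    , _) _        = s≤s z≤n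
minimalInterval-start p q (suc (suc i) , j) (P⊆ , _) =
  contradiction refl (All.lookup x∉tail (lookup (⊆-trans P⊆ (substring-∷-⊆ 0F _ i j)) (here refl)))
  where
  x∉tail : All (0F ≢_) (replicate p 1F ++ replicate q 2F ++ 3F ∷ [])
  x∉tail = All.++⁺ (All.replicate⁺ p λ ()) (All.++⁺ (All.replicate⁺ q λ ()) ((λ ()) ∷ []))

-- The letter y occurs only at the last position, so the interval must reach it.
minimalInterval-end : ∀ p q I → IsMinimalInterval pattern-xy (word p q) I → length (word p q) ≤ proj₂ I
minimalInterval-end p q (i , j) (P⊆ , _) = subst (_≤ j) lengths
  (∈-take-++⇒< j y∉init (subst (λ X → 3F ∈ take j X) word≡init∷ʳy
    (lookup (⊆-trans P⊆ (drop-⊆ (i ∸ 1) _)) (there (here refl)))))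
  where
  init : String 4
  init = 0F ∷ replicate p 1F ++ replicate q 2F
  word≡init∷ʳy : word p q ≡ init ++ 3F ∷ []
  word≡init∷ʳy = cong (0F ∷_) (sym (++-assoc (replicate p 1F) (replicate q 2F) (3F ∷ [])))
  y∉init : All (3F ≢_) init
  y∉init = (λ ()) ∷ All.++⁺ (All.replicate⁺ p λ ()) (All.replicate⁺ q λ ())
  lengths : suc (length init) ≡ length (word p q)
  lengths = sym (trans (cong length word≡init∷ʳy) (trans (length-++ init) (+-comm (length init) 1)))

-- The second string has no b, so a common subsequence uses at most the p + 2 letters of x aᵖ y.
lcs-word : ∀ p q r → lcs (word p q) (word r 0) ≤ p + 2
lcs-word p q r = lcs-upper (word p q) (word r 0) λ Z⊆A Z⊆B →
  ≤-trans (length-avoiding (0F ∷ replicate p 1F) q (All-resp-⊆ Z⊆B b∉B) Z⊆A)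
          (≤-reflexive (trans (cong (λ l → suc l + 1) (length-replicate p)) (sym (+-suc p 1))))
  where
  b∉B : All (2F ≢_) (word r 0)
  b∉B = (λ ()) ∷ All.++⁺ (All.replicate⁺ r λ ()) ((λ ()) ∷ [])

-- This is `table-lower` with `m = suc p`, the length of the common prefix x aᵖ, and `d = q`, since
-- the length 2 + p + q exceeds the `lcs` by at least `q`. The parallelogram fits exactly:
-- `suc (m + d)` is the length of the word.
table-word-lower : ∀ p q → (2 + p) * suc q ≤ length (table (word p q) (word (p + q) 0))
table-word-lower p q = table-lower
  (≤-trans (s≤s (m≤n⇒m≤1+n (≤-trans (m≤m+n p q) (m≤m+n (p + q) 0)))) (≤-reflexive (sym (length-word (p + q) 0))))
  (cong (0F ∷_) (take-replicate-++ 1F p q _ _))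
  (≤-trans (≤-reflexive (sym diagonals))
           (∸-mono (≤-reflexive (sym (length-word p q))) (lcs-word p q (p + q))))
  (≤-reflexive (sym (length-word p q)))
  where
  diagonals : 2 + (p + q) ∸ (p + 2) ≡ q
  diagonals = trans (cong (2 + (p + q) ∸_) (+-comm p 2)) (m+n∸m≡n p q)

-- Balanced exponents and the final estimates.

square-halves : ∀ m → (2 + m) * (2 + m) ≤ 4 * ((2 + ⌊ m /2⌋) * suc ⌈ m /2⌉)
square-halves m = subst₂ _≤_ (cong (λ k → (2 + k) * (2 + k)) (⌊n/2⌋+⌈n/2⌉≡n m)) (regroup ⌊ m /2⌋ ⌈ m /2⌉)
  -- With p and q the two halves of m, one copy of 2 + p + q is bounded by 2(2 + p) and the other by
  -- 2(1 + q).
  (*-mono-≤ (≤-trans (s≤s (s≤s (+-monoʳ-≤ ⌊ m /2⌋ ⌈m/2⌉≤1+⌊m/2⌋))) (≤-trans (n≤1+n _) (≤-reflexive (double₁ ⌊ m /2⌋))))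
            (≤-trans (s≤s (s≤s (+-monoˡ-≤ ⌈ m /2⌉ (⌊n/2⌋≤⌈n/2⌉ m)))) (≤-reflexive (double₂ ⌈ m /2⌉))))
  where
  ⌈m/2⌉≤1+⌊m/2⌋ : ⌈ m /2⌉ ≤ suc ⌊ m /2⌋
  -- By definition the two sides are the floors of half of 1 + m and of half of 2 + m.
  ⌈m/2⌉≤1+⌊m/2⌋ = ⌊n/2⌋-mono (n≤1+n (suc m))
  double₁ : ∀ p → 3 + (p + suc p) ≡ 2 * (2 + p)
  double₁ = solve-∀
  double₂ : ∀ q → 2 + (q + q) ≡ 2 * suc q
  double₂ = solve-∀
  regroup : ∀ p q → 2 * (2 + p) * (2 * suc q) ≡ 4 * ((2 + p) * suc q)
  regroup = solve-∀

wordInput : ∀ m → Input 4 (2 + m)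
wordInput m = record
  { A     = word ⌊ m /2⌋ ⌈ m /2⌉
  ; B     = word (⌊ m /2⌋ + ⌈ m /2⌉) 0
  ; P     = pattern-xy
  ; |A|≡n = trans (length-word ⌊ m /2⌋ ⌈ m /2⌉) (cong (2 +_) (⌊n/2⌋+⌈n/2⌉≡n m))
  ; |B|≡n = trans (length-word (⌊ m /2⌋ + ⌈ m /2⌉) 0)
                  (cong (2 +_) (trans (+-identityʳ (⌊ m /2⌋ + ⌈ m /2⌉)) (⌊n/2⌋+⌈n/2⌉≡n m)))
  ; 1≤r   = s≤s z≤n
  ; r≤n   = s≤s (s≤s z≤n)
  }

module _ (w : WorkSpace) (m : ℕ) where
  open Input (wordInput m)

  spaceIII-word : spaceIII w (wordInput m) ≡ w (wordInput m) + ((2 + m) + (2 + m))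
  spaceIII-word
    rewrite trimmedPrefix-empty P A (minimalInterval-start ⌊ m /2⌋ ⌈ m /2⌉)
          | trimmedPrefix-empty P B (minimalInterval-start (⌊ m /2⌋ + ⌈ m /2⌉) 0)
          | trimmedSuffix-empty P A (minimalInterval-end ⌊ m /2⌋ ⌈ m /2⌉)
          | trimmedSuffix-empty P B (minimalInterval-end (⌊ m /2⌋ + ⌈ m /2⌉) 0) =
    -- For empty strings the prefix and suffix spaces compute to 0, leaving only `intervalSpace`.
    trans (+-identityʳ _) (trans (+-identityʳ _) (cong (w (wordInput m) +_) (cong₂ _+_ |A|≡n |B|≡n)))

lemma6 : (w : WorkSpace) (k : ℕ) →
    (∀ {σ n} (I : Input σ n) → w I ≤ k * n) →
    ∃[ σ ] ∃[ c₁ ] ∃[ c₂ ] ∃[ c₃ ] ∃[ n₀ ]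
    (∀ n → n₀ ≤ n →
    Σ[ I ∈ Input σ n ]
    Input.P I ⊆ Input.A I × Input.P I ⊆ Input.B I
    × spaceIII w I ≤ c₁ * n
    × n * n ≤ c₂ * spaceII w I
    × spaceII w I ≤ c₃ * (n * n))
-- Four letters; `k + 2` is the working space and the two interval arrays; 4 comes from
-- `square-halves` and `k + 8` from `spaceII-upper`; the letters x and y force n ≥ 2.
lemma6 w k w≤ = 4 , k + 2 , 4 , k + 8 , 2 , inputs
  where
  open ≤-Reasoning
  inputs : ∀ n → 2 ≤ n → Σ[ I ∈ Input 4 n ]
    Input.P I ⊆ Input.A I × Input.P I ⊆ Input.B I
    × spaceIII w I ≤ (k + 2) * n
    × n * n ≤ 4 * spaceII w I
    × spaceII w I ≤ (k + 8) * (n * n)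
  inputs (suc (suc m)) (s≤s (s≤s _)) =
    I , pattern-⊆-word p q , pattern-⊆-word (p + q) 0 , linear , quadratic , spaceII-upper w {k} I (w≤ I)
    where
    p = ⌊ m /2⌋
    q = ⌈ m /2⌉
    n = suc (suc m)
    I = wordInput m
    collect : ∀ k n → k * n + (n + n) ≡ (k + 2) * n
    collect = solve-∀
    linear : spaceIII w I ≤ (k + 2) * n
    linear = begin
      spaceIII w I    ≡⟨ spaceIII-word w m ⟩
      w I + (n + n)   ≤⟨ +-monoˡ-≤ (n + n) (w≤ I) ⟩
      k * n + (n + n) ≡⟨ collect k n ⟩
      (k + 2) * n     ∎
    quadratic : n * n ≤ 4 * spaceII w I
    quadratic = begin
      n * n                         ≤⟨ square-halves m ⟩
      4 * ((2 + p) * suc q)         ≤⟨ *-monoʳ-≤ 4 (table-word-lower p q) ⟩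
      -- The table of A against B is already quadratic; the remaining steps only add the other
      -- summands.
      4 * length (table A B)        ≤⟨ *-monoʳ-≤ 4 (m≤m+n (length (table A B)) (length (table B A))) ⟩
      4 * prefixSpace A B           ≤⟨ *-monoʳ-≤ 4 (m≤n+m (prefixSpace A B) (intervalSpace w I)) ⟩
      4 * (intervalSpace w I + prefixSpace A B)
                                    ≤⟨ *-monoʳ-≤ 4 (m≤m+n (intervalSpace w I + prefixSpace A B) (suffixSpace A B)) ⟩
      4 * spaceII w I               ∎
      where open Input I
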